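{- If $\langle A,\to\rangle$ is a conditional algebra, then its expanded Stone space $\langle\mathrm{Ul}(A),\tau_s,T_A\rangle$ is a conditional space.
   Context: A conditional algebra is a pair $\langle A,\to\rangle$ where $A$ is a Boolean algebra and $\to$ is a binary operation with, for all $a,b,c$: $a\to 1=1$; $(a\to b)\wedge(a\to c)=a\to(b\wedge c)$; $(a\vee b)\to c\le (a\to c)\wedge(b\to c)$. $\langle\mathrm{Ul}(A),\tau_s\rangle$ is the Stone space of $A$, $\varphi(a)=\{u:a\in u\}$; filters include the improper filter $A$, and $\varphi(F)=\{u:F\subseteq u\}$. $D^{\to}_X(Y)=\{b:\exists a\in Y,\ a\to b\in X\}$; $T_A(u,Z,v)$ iff there is a filter $F$ with $Z=\varphi(F)$ and $D^{\to}_u(F)\subseteq v$. A conditional space is a triple $\langle X,\tau,T\rangle$ where $\langle X,\tau\rangle$ is a Boolean (compact, Hausdorff, zero-dimensional) space and $T\subseteq X\times\mathcal{C}(\tau)\times X$ ($\mathcal{C}(\tau)$ the closed sets) satisfies: (T1) for every $x\in X$ and closed $Y$, $T(x,Y)=\{y:T(x,Y,y)\}$ is closed; (T2) for all clopen $U,V$, the set $U\to_T V=\{x:\text{for all } Z\subseteq U \text{ with } Z \text{ closed},\ T(x,Z)\subseteq V\}$ is clopen; (T3) for closed $Y$: $T(x,Y,y)$ iff $T(x,U,y)$ for every clopen $U\supseteq Y$. -}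

module Defs where

open import Algebra.Lattice.Bundles using (BooleanAlgebra)
import Algebra.Lattice.Properties.Lattice as LatticeProperties
open import Data.List using (List)
open import Data.List.Relation.Unary.Any using (Any)
open import Data.Product using (Σ; Σ-syntax; ∃-syntax; _×_; _,_; proj₁; proj₂)
open import Function.Base using (id; _∘_)
open import Function.Bundles using (_⇔_)
open import Level using (Level; _⊔_; suc)
open import Relation.Binary.Bundles using (Setoid; Poset)
open import Relation.Binary.Definitions using (_Respects_)
open import Relation.Nullary using (¬_)
open import Relation.Unary using (Pred; _∈_; _∉_; _⊆_; _≐_; _∩_; ∁; ⋃; Empty; Universal)

private
  variable
    x e o : Level

-- Algebras are setoid-based, so the conditional must be a congruence.
record ConditionalAlgebra c ℓ : Set (suc (c ⊔ ℓ)) where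
  infixr 5 _⇒_
  field
    booleanAlgebra : BooleanAlgebra c ℓ
  open BooleanAlgebra booleanAlgebra public renaming (¬_ to −_)
  open Poset (LatticeProperties.poset lattice) public using (_≤_)
  field
    _⇒_    : Carrier → Carrier → Carrier
    ⇒-cong : ∀ {a a′ b b′} → a ≈ a′ → b ≈ b′ → (a ⇒ b) ≈ (a′ ⇒ b′)
    ⇒-⊤    : ∀ a → (a ⇒ ⊤) ≈ ⊤
    ⇒-∧    : ∀ a b c → ((a ⇒ b) ∧ (a ⇒ c)) ≈ (a ⇒ (b ∧ c))
    ∨-⇒    : ∀ a b c → ((a ∨ b) ⇒ c) ≤ ((a ⇒ c) ∧ (b ⇒ c))

-- Point-set topology on a setoid of points.  Subsets are predicates at the
-- level of the points, compared by _≐_; families are indexed by types at that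
-- same level.  Under excluded middle neither bound loses anything: every
-- predicate is equivalent to one in the lowest universe, and every family of
-- sets has a subfamily indexed by points with the same union.
module Topology (X : Setoid x e) (Open : Pred (Setoid.Carrier X) x → Set o) where

  open Setoid X using (_≈_) renaming (Carrier to Point)

  Subset : Set (suc x)
  Subset = Pred Point x

  Closed : Subset → Set o
  Closed Y = Open (∁ Y)

  Clopen : Subset → Set o
  Clopen U = Open U × Closed U

  ClosedSet : Set (suc x ⊔ o)
  ClosedSet = Σ Subset Closed

  record IsTopology : Set (suc x ⊔ e ⊔ o) where
    field
      respects-≈ : ∀ {U} → Open U → U Respects _≈_
      respects-≐ : ∀ {U V} → U ≐ V → Open U → Open V
      empty      : ∀ {U} → Empty U → Open U
      whole      : ∀ {U} → Universal U → Open U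
      meet       : ∀ {U V} → Open U → Open V → Open (U ∩ V)
      union      : ∀ {I : Set x} (U : I → Subset) → (∀ i → Open (U i)) → Open (⋃ I U)

  Compact : Set (suc x ⊔ o)
  Compact = ∀ {I : Set x} (U : I → Subset) → (∀ i → Open (U i)) → Universal (⋃ I U) →
            Σ[ is ∈ List I ] (∀ y → Any (λ i → y ∈ U i) is)

  Hausdorff : Set (suc x ⊔ e ⊔ o)
  Hausdorff = ∀ y z → ¬ (y ≈ z) →
              Σ[ U ∈ Subset ] Σ[ V ∈ Subset ]
                Open U × Open V × y ∈ U × z ∈ V × Empty (U ∩ V)

  ZeroDimensional : Set (suc x ⊔ o)
  ZeroDimensional = ∀ {U} → Open U → ∀ {y} → y ∈ U →
                    Σ[ W ∈ Subset ] Clopen W × y ∈ W × W ⊆ U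

  record IsBooleanSpace : Set (suc x ⊔ e ⊔ o) where
    field
      isTopology      : IsTopology
      compact         : Compact
      hausdorff       : Hausdorff
      zeroDimensional : ZeroDimensional

  -- T x Y is the set { y : T(x, Y, y) }.
  module _ (T : Point → ClosedSet → Subset) where

    -- Quantifying over closed subsets puts this set one universe above Subset.
    Conditional : Subset → Subset → Pred Point (suc x ⊔ o)
    Conditional U V y = (Z : ClosedSet) → proj₁ Z ⊆ U → T y Z ⊆ V

    record IsConditionalSpace : Set (suc x ⊔ e ⊔ o) where
      field
        isBooleanSpace : IsBooleanSpace
        -- T is a relation on points up to _≈_ and closed sets up to _≐_.
        T-resp : ∀ {y y′ z z′} {Y Y′ : ClosedSet} → y ≈ y′ → proj₁ Y ≐ proj₁ Y′ → z ≈ z′ →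
                 z ∈ T y Y → z′ ∈ T y′ Y′
        T1 : ∀ y (Y : ClosedSet) → Closed (T y Y)
        T2 : ∀ {U V} → Clopen U → Clopen V →
             Σ[ W ∈ Subset ] Clopen W × W ≐ Conditional U V
        T3 : ∀ y (Y : ClosedSet) z →
             z ∈ T y Y ⇔
             (∀ U (clopen : Clopen U) → proj₁ Y ⊆ U → z ∈ T y (U , proj₂ clopen))

module StoneSpace {c ℓ} (𝔸 : ConditionalAlgebra c ℓ) where

  open ConditionalAlgebra 𝔸

  record IsFilter (F : Pred Carrier (c ⊔ ℓ)) : Set (c ⊔ ℓ) where
    field
      ⊤-mem    : ⊤ ∈ F
      upward   : ∀ {a b} → a ≤ b → a ∈ F → b ∈ F
      ∧-closed : ∀ {a b} → a ∈ F → b ∈ F → (a ∧ b) ∈ F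

  record Ultrafilter : Set (suc (c ⊔ ℓ)) where
    field
      set      : Pred Carrier (c ⊔ ℓ)
      isFilter : IsFilter set
      proper   : ⊥ ∉ set
      maximal  : ∀ (G : Pred Carrier (c ⊔ ℓ)) → IsFilter G → ⊥ ∉ G → set ⊆ G → G ⊆ set

  open Ultrafilter public using (set)

  Ul : Setoid (suc (c ⊔ ℓ)) (c ⊔ ℓ)
  Ul = record
    { Carrier       = Ultrafilter
    ; _≈_           = λ u v → set u ≐ set v
    ; isEquivalence = record
      { refl  = id , id
      ; sym   = λ (p , q) → q , p
      ; trans = λ (p , q) (r , s) → r ∘ p , q ∘ s
      }
    }

  φ : Carrier → Pred Ultrafilter (c ⊔ ℓ)
  φ a u = a ∈ set u

  φF : Pred Carrier (c ⊔ ℓ) → Pred Ultrafilter (c ⊔ ℓ)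
  φF F u = F ⊆ set u

  -- The topology with basis { φ a : a ∈ A }.
  τₛ : Pred Ultrafilter (suc (c ⊔ ℓ)) → Set (suc (c ⊔ ℓ))
  τₛ U = ∀ {u} → u ∈ U → ∃[ a ] u ∈ φ a × φ a ⊆ U

  D : Pred Carrier (c ⊔ ℓ) → Pred Carrier (c ⊔ ℓ) → Pred Carrier (c ⊔ ℓ)
  D X Y b = ∃[ a ] a ∈ Y × (a ⇒ b) ∈ X

  open Topology Ul τₛ

  Tᴬ : Ultrafilter → ClosedSet → Subset
  Tᴬ u (Z , _) v =
    Σ[ F ∈ Pred Carrier (c ⊔ ℓ) ] IsFilter F × Z ≐ φF F × D (set u) F ⊆ set v

{-# OPTIONS --safe #-}
module Submission where

-- A closed set Y of ultrafilters is φ(F) for exactly one filter F, namely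
-- F_Y = { a : Y ⊆ φ(a) }; hence T_A(u, Y, v) says that D_u(F_Y) ⊆ v.  This set
-- of v is an intersection of basic clopens (T1), and D_u(F_Y) is the union of
-- D_u(F_U) over the clopen U ⊇ Y (T3).  For (T2), φ(a) →_T φ(b) = φ(a → b): if
-- a → b ∉ u then D_u(↑a) = { d : a → d ∈ u } is a filter without b, and an
-- ultrafilter extending it without b refutes φ(a) →_T φ(b) at u.
--
-- Choice enters through the existence of ultrafilters.  Excluded middle for
-- types, as opposed to propositions, selects an element of every inhabited
-- type; function extensionality makes the selection depend only on the
-- extension of a subset, once subsets are coded by characteristic functions.

open import Defs
open import Axiom.ExcludedMiddle using (ExcludedMiddle)
open import Axiom.Extensionality.Propositional using (Extensionality)
import Algebra.Lattice.Properties.BooleanAlgebra as BooleanAlgebraProperties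
import Algebra.Lattice.Properties.Lattice as LatticeProperties
open import Data.Bool using (Bool; true; false)
open import Data.Empty using (⊥-elim)
open import Data.List using ([]; _∷_; _++_)
open import Data.List.Relation.Unary.Any using (Any; here)
open import Data.List.Relation.Unary.Any.Properties using (++⁺ˡ; ++⁺ʳ)
open import Data.Product using (Σ-syntax; ∃-syntax; _×_; _,_; proj₁; proj₂)
open import Data.Sum using (_⊎_; inj₁; inj₂)
open import Function.Base using (id; _∘_)
open import Function.Bundles using (_⇔_; mk⇔)
open import Level using (Level; _⊔_; suc; Lift; lift; lower)
import Relation.Binary.Lattice as OrderTheory
open import Relation.Binary.PropositionalEquality using (_≡_; refl; sym)
import Relation.Binary.Reasoning.Setoid as SetoidReasoning
open import Relation.Nullary using (¬_; Dec; yes; no; does; contradiction)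
open import Relation.Nullary.Decidable using (dec-true; decidable-stable)
open import Relation.Unary using (Pred; _∈_; _∉_; _⊆_; _⊈_; _≐_)

-- Zorn's lemma

𝒫 : ∀ {a} → Set a → Set a
𝒫 A = A → Bool

⟦_⟧ : ∀ {a} {A : Set a} → 𝒫 A → Pred A _
⟦ X ⟧ x = X x ≡ true

InSome : ∀ {a} {A : Set a} → 𝒫 (𝒫 A) → Pred A a
InSome 𝒮 x = ∃[ X ] X ∈ ⟦ 𝒮 ⟧ × x ∈ ⟦ X ⟧

IsChain : ∀ {a} {A : Set a} → 𝒫 (𝒫 A) → Set a
IsChain 𝒮 = ∀ {X Y} → X ∈ ⟦ 𝒮 ⟧ → Y ∈ ⟦ 𝒮 ⟧ → ⟦ X ⟧ ⊆ ⟦ Y ⟧ ⊎ ⟦ Y ⟧ ⊆ ⟦ X ⟧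

module _ (em : ∀ {p} → ExcludedMiddle p) where

  ⌊_⌋ : ∀ {a p} {A : Set a} → Pred A p → 𝒫 A
  ⌊ P ⌋ x = does (em {P = P x})

  ⌊⌋⁺ : ∀ {a p} {A : Set a} (P : Pred A p) → P ⊆ ⟦ ⌊ P ⌋ ⟧
  ⌊⌋⁺ P {x} = dec-true (em {P = P x})

  ⌊⌋⁻ : ∀ {a p} {A : Set a} (P : Pred A p) → ⟦ ⌊ P ⌋ ⟧ ⊆ P
  ⌊⌋⁻ P {x} e with em {P = P x}
  ... | yes Px = Px
  ⌊⌋⁻ P {x} () | no _

  ⋃ᵇ : ∀ {a} {A : Set a} → 𝒫 (𝒫 A) → 𝒫 A
  ⋃ᵇ 𝒮 = ⌊ InSome 𝒮 ⌋

  ∈-⋃ᵇ : ∀ {a} {A : Set a} (𝒮 : 𝒫 (𝒫 A)) {X} → X ∈ ⟦ 𝒮 ⟧ → ⟦ X ⟧ ⊆ ⟦ ⋃ᵇ 𝒮 ⟧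
  ∈-⋃ᵇ 𝒮 {X} X∈𝒮 x∈X = ⌊⌋⁺ (InSome 𝒮) (X , X∈𝒮 , x∈X)

  ⋃ᵇ-least : ∀ {a p} {A : Set a} (𝒮 : 𝒫 (𝒫 A)) {P : Pred A p} →
             (∀ {X} → X ∈ ⟦ 𝒮 ⟧ → ⟦ X ⟧ ⊆ P) → ⟦ ⋃ᵇ 𝒮 ⟧ ⊆ P
  ⋃ᵇ-least 𝒮 all x∈⋃ with ⌊⌋⁻ (InSome 𝒮) x∈⋃
  ... | _ , X∈𝒮 , x∈X = all X∈𝒮 x∈X

  module Zorn
    (ext : ∀ {a b} → Extensionality a b)
    {a g : Level} {A : Set a} (Good : 𝒫 A → Set g)
    (⋃-good : ∀ 𝒮 → ∃[ X ] X ∈ ⟦ 𝒮 ⟧ → IsChain 𝒮 →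
              (∀ {X} → X ∈ ⟦ 𝒮 ⟧ → Good X) → Good (⋃ᵇ 𝒮))
    (base : 𝒫 A) (base-good : Good base)
    where

    -- Extensionality yields `≡`, so matching on `refl` below also identifies `next X` with
    -- `next Y`.
    ⊆-antisym : ∀ (X Y : 𝒫 A) → ⟦ X ⟧ ⊆ ⟦ Y ⟧ → ⟦ Y ⟧ ⊆ ⟦ X ⟧ → X ≡ Y
    ⊆-antisym X Y X⊆Y Y⊆X = ext λ x → pointwise (X x) (Y x) X⊆Y Y⊆X
      where
      pointwise : ∀ b b′ → (b ≡ true → b′ ≡ true) → (b′ ≡ true → b ≡ true) → b ≡ b′
      pointwise true  _     f _ = sym (f refl)
      pointwise false true  _ g = g refl
      pointwise false false _ _ = refl

    Extension : 𝒫 A → Set (a ⊔ g)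
    Extension X = Σ[ Y ∈ 𝒫 A ] Good Y × ⟦ X ⟧ ⊆ ⟦ Y ⟧ × ⟦ Y ⟧ ⊈ ⟦ X ⟧

    -- The choice function: a positive decision carries a particular larger good set. The decision
    -- is an argument so that proofs can split on it.
    extend : ∀ X → Dec (Extension X) → 𝒫 A
    extend X (yes (Y , _)) = Y
    extend X (no _)        = X

    next : 𝒫 A → 𝒫 A
    next X = extend X em

    ⊆-next : ∀ X → ⟦ X ⟧ ⊆ ⟦ next X ⟧
    ⊆-next X = helper em
      where
      helper : ∀ d → ⟦ X ⟧ ⊆ ⟦ extend X d ⟧
      helper (yes (_ , _ , X⊆Y , _)) = X⊆Y
      helper (no _)                  = id

    next-good : ∀ X → Good X → Good (next X)
    next-good X good = helper em
      where
      helper : ∀ d → Good (extend X d)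
      helper (yes (_ , Y-good , _)) = Y-good
      helper (no _)                 = good

    next⊆⇒maximal : ∀ X → ⟦ next X ⟧ ⊆ ⟦ X ⟧ → ¬ Extension X
    next⊆⇒maximal X = helper em
      where
      helper : ∀ d → ⟦ extend X d ⟧ ⊆ ⟦ X ⟧ → ¬ Extension X
      helper (yes (_ , _ , _ , Y⊈X)) Y⊆X _ = Y⊈X Y⊆X
      helper (no ¬extension)         _     = ¬extension

    -- Bourbaki–Witt: the tower is a chain, so its union is a fixed point of next.
    data Tower : 𝒫 A → Set a where
      start : Tower base
      step  : ∀ {X} → Tower X → Tower (next X)
      sup   : ∀ 𝒮 → ∃[ X ] X ∈ ⟦ 𝒮 ⟧ → (∀ {X} → X ∈ ⟦ 𝒮 ⟧ → Tower X) → Tower (⋃ᵇ 𝒮)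

    base⊆ : ∀ {X} → Tower X → ⟦ base ⟧ ⊆ ⟦ X ⟧
    base⊆ start               b = b
    base⊆ (step {X} t)        b = ⊆-next X (base⊆ t b)
    base⊆ (sup 𝒮 (X , X∈𝒮) t) b = ∈-⋃ᵇ 𝒮 X∈𝒮 (base⊆ (t X∈𝒮) b)

    -- The extreme elements of the Bourbaki-Witt argument: no `next` step taken strictly below `Y`
    -- leaves `Y`.
    IsGap : 𝒫 A → Set a
    IsGap Y = ∀ {X} → Tower X → ⟦ X ⟧ ⊆ ⟦ Y ⟧ → X ≡ Y ⊎ ⟦ next X ⟧ ⊆ ⟦ Y ⟧

    -- Induction on the tower of `X`: a step from inside `Y` stays inside or starts at `Y` itself,
    -- and a union either has a member above `next Y` or has all its members inside `Y`.
    gap-compare : ∀ {Y} → Tower Y → IsGap Y → ∀ {X} → Tower X →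
                  ⟦ X ⟧ ⊆ ⟦ Y ⟧ ⊎ ⟦ next Y ⟧ ⊆ ⟦ X ⟧
    gap-compare tY gap start = inj₁ (base⊆ tY)
    gap-compare tY gap (step {X} tX) with gap-compare tY gap tX
    ... | inj₂ nextY⊆X = inj₂ (⊆-next X ∘ nextY⊆X)
    ... | inj₁ X⊆Y with gap tX X⊆Y
    ...   | inj₁ refl    = inj₂ id
    ...   | inj₂ nextX⊆Y = inj₁ nextX⊆Y
    gap-compare {Y} tY gap (sup 𝒮 _ t)
      with em {P = ∃[ X ] X ∈ ⟦ 𝒮 ⟧ × ⟦ next Y ⟧ ⊆ ⟦ X ⟧}
    ... | yes (_ , X∈𝒮 , nextY⊆X) = inj₂ (∈-⋃ᵇ 𝒮 X∈𝒮 ∘ nextY⊆X)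
    ... | no none = inj₁ (⋃ᵇ-least 𝒮 below)
      where
      below : ∀ {X} → X ∈ ⟦ 𝒮 ⟧ → ⟦ X ⟧ ⊆ ⟦ Y ⟧
      below X∈𝒮 with gap-compare tY gap (t X∈𝒮)
      ... | inj₁ X⊆Y     = X⊆Y
      ... | inj₂ nextY⊆X = ⊥-elim (none (_ , X∈𝒮 , nextY⊆X))

    -- Induction on the tower of `Y`: earlier stages are gaps already, so `gap-compare` places `X`
    -- relative to them.
    tower-gap : ∀ {Y} → Tower Y → IsGap Y
    tower-gap start {X} tX X⊆base = inj₁ (⊆-antisym X base X⊆base (base⊆ tX))
    tower-gap (step {Y} tY) {X} tX X⊆nextY with gap-compare tY (tower-gap tY) tX
    ... | inj₂ nextY⊆X = inj₁ (⊆-antisym X (next Y) X⊆nextY nextY⊆X)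
    ... | inj₁ X⊆Y with tower-gap tY tX X⊆Y
    ...   | inj₁ refl    = inj₂ id
    ...   | inj₂ nextX⊆Y = inj₂ (⊆-next Y ∘ nextX⊆Y)
    tower-gap (sup 𝒮 _ t) {X} tX X⊆⋃
      with em {P = ∃[ Y ] Y ∈ ⟦ 𝒮 ⟧ × ⟦ Y ⟧ ⊈ ⟦ X ⟧}
    ... | no none = inj₁ (⊆-antisym X (⋃ᵇ 𝒮) X⊆⋃ (⋃ᵇ-least 𝒮 below))
      where
      below : ∀ {Y} → Y ∈ ⟦ 𝒮 ⟧ → ⟦ Y ⟧ ⊆ ⟦ X ⟧
      below Y∈𝒮 = decidable-stable em λ Y⊈X → none (_ , Y∈𝒮 , Y⊈X)
    -- Such a member `Y` contains `X` strictly, so its own gap property puts `next X` inside it and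
    -- hence inside the union.
    ... | yes (Y , Y∈𝒮 , Y⊈X) with gap-compare (t Y∈𝒮) (tower-gap (t Y∈𝒮)) tX
    ...   | inj₂ nextY⊆X = ⊥-elim (Y⊈X (nextY⊆X ∘ ⊆-next Y))
    ...   | inj₁ X⊆Y with tower-gap (t Y∈𝒮) tX X⊆Y
    ...     | inj₁ refl    = ⊥-elim (Y⊈X id)
    ...     | inj₂ nextX⊆Y = inj₂ (∈-⋃ᵇ 𝒮 Y∈𝒮 ∘ nextX⊆Y)

    tower-total : ∀ {X Y} → Tower X → Tower Y → ⟦ X ⟧ ⊆ ⟦ Y ⟧ ⊎ ⟦ Y ⟧ ⊆ ⟦ X ⟧
    tower-total {Y = Y} tX tY with gap-compare tY (tower-gap tY) tX
    ... | inj₁ X⊆Y     = inj₁ X⊆Y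
    ... | inj₂ nextY⊆X = inj₂ (nextY⊆X ∘ ⊆-next Y)

    tower-good : ∀ {X} → Tower X → Good X
    tower-good start              = base-good
    tower-good (step {X} t)       = next-good X (tower-good t)
    tower-good (sup 𝒮 nonempty t) =
      ⋃-good 𝒮 nonempty (λ X∈𝒮 Y∈𝒮 → tower-total (t X∈𝒮) (t Y∈𝒮)) (tower-good ∘ t)

    top : 𝒫 A
    top = ⋃ᵇ ⌊ Tower ⌋

    top-tower : Tower top
    top-tower = sup ⌊ Tower ⌋ (base , ⌊⌋⁺ Tower start) (⌊⌋⁻ Tower)

    zorn : Σ[ M ∈ 𝒫 A ] Good M × ⟦ base ⟧ ⊆ ⟦ M ⟧ ×
           (∀ Y → Good Y → ⟦ M ⟧ ⊆ ⟦ Y ⟧ → ⟦ Y ⟧ ⊆ ⟦ M ⟧)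
    zorn = top , tower-good top-tower , base⊆ top-tower , λ Y Y-good top⊆Y →
      decidable-stable em λ Y⊈top →
        -- `next top` is again in the tower, hence inside the union `top`.
        next⊆⇒maximal top (∈-⋃ᵇ ⌊ Tower ⌋ (⌊⌋⁺ Tower (step top-tower)))
          (Y , Y-good , top⊆Y , Y⊈top)

-- Order in conditional algebras

module ConditionalAlgebraProperties {c ℓ} (𝔸 : ConditionalAlgebra c ℓ) where

  open ConditionalAlgebra 𝔸 renaming (sym to ≈-sym; trans to ≈-trans; refl to ≈-refl)
  open BooleanAlgebraProperties booleanAlgebra
    using (∧-zeroʳ; ∧-identityʳ; ∨-identityˡ; ¬-involutive)
  open OrderTheory.Lattice (LatticeProperties.∨-∧-orderTheoreticLattice lattice) public
    using (x∧y≤x; x∧y≤y; ∧-greatest; y≤x∨y; ∨-least; antisym)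
    renaming (refl to ≤-refl; trans to ≤-trans; reflexive to ≤-reflexive)

  ≤⊤ : ∀ {a} → a ≤ ⊤
  ≤⊤ = ≈-sym (∧-identityʳ _)

  ⊥≤ : ∀ {a} → ⊥ ≤ a
  ⊥≤ {a} = ≈-sym (≈-trans (∧-comm ⊥ a) (∧-zeroʳ a))

  ∧-mono-≤ : ∀ {a a′ b b′} → a ≤ a′ → b ≤ b′ → (a ∧ b) ≤ (a′ ∧ b′)
  ∧-mono-≤ p q = ∧-greatest (≤-trans (x∧y≤x _ _) p) (≤-trans (x∧y≤y _ _) q)

  ∧≤⊥⇒≤− : ∀ {a b} → (a ∧ b) ≤ ⊥ → a ≤ (− b)
  -- As `x ≤ y` unfolds to `x ≈ x ∧ y`, the chain itself proves the inequality.
  ∧≤⊥⇒≤− {a} {b} a∧b≤⊥ = begin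
    a                      ≈⟨ ∧-identityʳ a ⟨
    a ∧ ⊤                  ≈⟨ ∧-congˡ (∨-complementʳ b) ⟨
    a ∧ (b ∨ − b)          ≈⟨ ∧-distribˡ-∨ a b (− b) ⟩
    (a ∧ b) ∨ (a ∧ − b)    ≈⟨ ∨-congʳ (antisym a∧b≤⊥ ⊥≤) ⟩
    ⊥ ∨ (a ∧ − b)          ≈⟨ ∨-identityˡ _ ⟩
    a ∧ − b                ∎
    where open SetoidReasoning setoid

  ∧−≤⊥⇒≤ : ∀ {a b} → (a ∧ − b) ≤ ⊥ → a ≤ b
  ∧−≤⊥⇒≤ a∧−b≤⊥ = ≤-trans (∧≤⊥⇒≤− a∧−b≤⊥) (≤-reflexive (¬-involutive _))

  ≤−− : ∀ {a} → a ≤ (− (− a))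
  ≤−− = ≤-reflexive (≈-sym (¬-involutive _))

  ⊤≤⇒⊤ : ∀ {a} → ⊤ ≤ (a ⇒ ⊤)
  ⊤≤⇒⊤ = ≤-reflexive (≈-sym (⇒-⊤ _))

  ⇒-monoʳ-≤ : ∀ {a b b′} → b ≤ b′ → (a ⇒ b) ≤ (a ⇒ b′)
  ⇒-monoʳ-≤ {a} {b} {b′} b≤b′ = ≈-trans (⇒-cong ≈-refl b≤b′) (≈-sym (⇒-∧ a b b′))

  ⇒-antiˡ-≤ : ∀ {a a′ b} → a ≤ a′ → (a′ ⇒ b) ≤ (a ⇒ b)
  ⇒-antiˡ-≤ {a} {a′} {b} a≤a′ =
    ≤-trans (≤-reflexive (⇒-cong a′≈a∨a′ ≈-refl)) (≤-trans (∨-⇒ a a′ b) (x∧y≤x _ _))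
    where
    a′≈a∨a′ : a′ ≈ (a ∨ a′)
    a′≈a∨a′ = antisym (y≤x∨y a a′) (∨-least a≤a′ ≤-refl)

module StoneDuality
  (em : ∀ {p} → ExcludedMiddle p) (ext : ∀ {a b} → Extensionality a b)
  {c ℓ : Level} (𝔸 : ConditionalAlgebra c ℓ)
  where

  open ConditionalAlgebra 𝔸 using (Carrier; _≤_; _∧_; −_; ⊤; ⊥; _⇒_; ⇒-∧; ∧-complementʳ)
  open ConditionalAlgebraProperties 𝔸
  open StoneSpace 𝔸
  open Topology Ul τₛ
  open IsFilter

  -- Ultrafilters

  members : 𝒫 Carrier → Pred Carrier (c ⊔ ℓ)
  members X a = Lift (c ⊔ ℓ) (a ∈ ⟦ X ⟧)

  -- Excluded middle brings predicates of any level down to the level of filters.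
  small : ∀ {p} → Pred Carrier p → Pred Carrier (c ⊔ ℓ)
  small P = members (⌊_⌋ em P)

  small⁺ : ∀ {p} (P : Pred Carrier p) → P ⊆ small P
  small⁺ P = lift ∘ ⌊⌋⁺ em P

  small⁻ : ∀ {p} (P : Pred Carrier p) → small P ⊆ P
  small⁻ P = ⌊⌋⁻ em P ∘ lower

  small-isFilter : ∀ {p} (P : Pred Carrier p) → ⊤ ∈ P →
    (∀ {a b} → a ≤ b → a ∈ P → b ∈ P) → (∀ {a b} → a ∈ P → b ∈ P → (a ∧ b) ∈ P) →
    IsFilter (small P)
  small-isFilter P ⊤∈P up meet = record
    { ⊤-mem    = small⁺ P ⊤∈P
    ; upward   = λ a≤b → small⁺ P ∘ up a≤b ∘ small⁻ P
    ; ∧-closed = λ a∈P b∈P → small⁺ P (meet (small⁻ P a∈P) (small⁻ P b∈P))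
    }

  -- For a filter `F`, the filter generated by `F` and `a`.
  adjoin : Pred Carrier (c ⊔ ℓ) → Carrier → Pred Carrier (c ⊔ ℓ)
  adjoin F a b = ∃[ d ] d ∈ F × (d ∧ a) ≤ b

  adjoin-isFilter : ∀ {F} a → IsFilter F → IsFilter (adjoin F a)
  adjoin-isFilter a F-filter = record
    { ⊤-mem    = ⊤ , F-filter .⊤-mem , ≤⊤
    ; upward   = λ b≤b′ (d , d∈F , d∧a≤b) → d , d∈F , ≤-trans d∧a≤b b≤b′
    ; ∧-closed = λ (d , d∈F , p) (e , e∈F , q) →
        d ∧ e , F-filter .∧-closed d∈F e∈F ,
        ∧-greatest (≤-trans (∧-mono-≤ (x∧y≤x d e) ≤-refl) p)
                   (≤-trans (∧-mono-≤ (x∧y≤y d e) ≤-refl) q)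
    }

  ⊆-adjoin : ∀ {F} a → F ⊆ adjoin F a
  ⊆-adjoin a b∈F = _ , b∈F , x∧y≤x _ _

  ∈-adjoin : ∀ {F} a → IsFilter F → a ∈ adjoin F a
  ∈-adjoin a F-filter = ⊤ , F-filter .⊤-mem , x∧y≤y _ _

  ↑_ : Carrier → Pred Carrier (c ⊔ ℓ)
  (↑ a) b = Lift (c ⊔ ℓ) (a ≤ b)

  ↑-isFilter : ∀ a → IsFilter (↑ a)
  ↑-isFilter a = record
    { ⊤-mem    = lift ≤⊤
    ; upward   = λ b≤b′ (lift a≤b) → lift (≤-trans a≤b b≤b′)
    ; ∧-closed = λ (lift p) (lift q) → lift (∧-greatest p q)
    }

  module _ (u : Ultrafilter) where
    open Ultrafilter u using (isFilter; proper; maximal)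

    ∈-up : ∀ {a b} → a ≤ b → a ∈ set u → b ∈ set u
    ∈-up = isFilter .upward

    consistent : ∀ {a} → a ∈ set u → (− a) ∉ set u
    consistent a∈u −a∈u =
      proper (∈-up (≤-reflexive (∧-complementʳ _)) (isFilter .∧-closed a∈u −a∈u))

    -- If adjoining `a` produces `⊥`, some member of `u` lies below `− a`; otherwise maximality
    -- would force `a` into `u`.
    complete : ∀ {a} → a ∉ set u → (− a) ∈ set u
    complete {a} a∉u with em {P = ⊥ ∈ adjoin (set u) a}
    ... | yes (d , d∈u , d∧a≤⊥) = ∈-up (∧≤⊥⇒≤− d∧a≤⊥) d∈u
    ... | no proper′ = contradiction (∈-adjoin a isFilter)
      (a∉u ∘ maximal _ (adjoin-isFilter a isFilter) proper′ (⊆-adjoin a))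

    ∉−⇒∈ : ∀ {a} → (− a) ∉ set u → a ∈ set u
    ∉−⇒∈ −a∉u = decidable-stable em (−a∉u ∘ complete)

  IsProperFilter : 𝒫 Carrier → Set (c ⊔ ℓ)
  IsProperFilter X = IsFilter (members X) × ⊥ ∉ ⟦ X ⟧

  ⋃-isProperFilter : ∀ 𝒮 → ∃[ X ] X ∈ ⟦ 𝒮 ⟧ → IsChain 𝒮 →
    (∀ {X} → X ∈ ⟦ 𝒮 ⟧ → IsProperFilter X) → IsProperFilter (⋃ᵇ em 𝒮)
  ⋃-isProperFilter 𝒮 (X₀ , X₀∈𝒮) chain good =
      small-isFilter (InSome 𝒮)
        (X₀ , X₀∈𝒮 , lower (proj₁ (good X₀∈𝒮) .⊤-mem))
        (λ a≤b (X , X∈𝒮 , a∈X) → X , X∈𝒮 , lower (proj₁ (good X∈𝒮) .upward a≤b (lift a∈X)))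
        meet
    , λ ⊥∈⋃ → let X , X∈𝒮 , ⊥∈X = ⌊⌋⁻ em (InSome 𝒮) ⊥∈⋃ in proj₂ (good X∈𝒮) ⊥∈X
    where
    -- The chain condition puts both elements into the larger of the two filters.
    meet : ∀ {a b} → a ∈ InSome 𝒮 → b ∈ InSome 𝒮 → (a ∧ b) ∈ InSome 𝒮
    meet (X , X∈𝒮 , a∈X) (Y , Y∈𝒮 , b∈Y) with chain X∈𝒮 Y∈𝒮
    ... | inj₁ X⊆Y = Y , Y∈𝒮 , lower (proj₁ (good Y∈𝒮) .∧-closed (lift (X⊆Y a∈X)) (lift b∈Y))
    ... | inj₂ Y⊆X = X , X∈𝒮 , lower (proj₁ (good X∈𝒮) .∧-closed (lift a∈X) (lift (Y⊆X b∈Y)))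

  -- Abstract, because unfolding Zorn's lemma makes type checking intractable.
  abstract
    ultrafilter-extension : ∀ {F} → IsFilter F → ⊥ ∉ F → ∃[ u ] F ⊆ set u
    ultrafilter-extension {F} F-filter ⊥∉F with
      Zorn.zorn em ext IsProperFilter ⋃-isProperFilter (⌊_⌋ em F)
        ( small-isFilter F (F-filter .⊤-mem) (F-filter .upward) (F-filter .∧-closed)
        , ⊥∉F ∘ ⌊⌋⁻ em F)
    ... | M , (M-filter , ⊥∉M) , F⊆M , M-max = u , lift ∘ F⊆M ∘ ⌊⌋⁺ em F
      where
      u : Ultrafilter
      u = record
        { set      = members M
        ; isFilter = M-filter
        ; proper   = ⊥∉M ∘ lower
        -- Zorn's lemma gives maximality among coded subsets, so `G` is coded first.
        ; maximal  = λ G G-filter ⊥∉G M⊆G a∈G → lift (M-max (⌊_⌋ em G)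
            ( small-isFilter G (G-filter .⊤-mem) (G-filter .upward) (G-filter .∧-closed)
            , ⊥∉G ∘ ⌊⌋⁻ em G)
            (⌊⌋⁺ em G ∘ M⊆G ∘ lift) (⌊⌋⁺ em G a∈G))
        }

  -- Adjoining `− a` keeps `F` proper: `d ∧ − a ≤ ⊥` would give `d ≤ a` and so put `a` in `F`.
  separation : ∀ {F a} → IsFilter F → a ∉ F → ∃[ u ] F ⊆ set u × a ∉ set u
  separation {F} {a} F-filter a∉F =
    let u , adjoin⊆u = ultrafilter-extension (adjoin-isFilter (− a) F-filter)
          (λ (d , d∈F , d∧−a≤⊥) → a∉F (F-filter .upward (∧−≤⊥⇒≤ d∧−a≤⊥) d∈F))
    in u , adjoin⊆u ∘ ⊆-adjoin (− a) ,
       λ a∈u → consistent u a∈u (adjoin⊆u (∈-adjoin (− a) F-filter))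

  φF⊆φ⇒∈ : ∀ {F a} → IsFilter F → φF F ⊆ φ a → a ∈ F
  φF⊆φ⇒∈ F-filter φF⊆φ = decidable-stable em λ a∉F →
    let u , F⊆u , a∉u = separation F-filter a∉F in a∉u (φF⊆φ {u} F⊆u)

  -- Compactness in filter form: a proper filter would extend to some `u`, where the refuting pair
  -- clashes. Both finiteness arguments below rest on it.
  refuted⇒improper : ∀ {F} → IsFilter F → (∀ u → ∃[ a ] a ∈ set u × (− a) ∈ F) → ⊥ ∈ F
  refuted⇒improper F-filter refuted = decidable-stable em λ ⊥∉F →
    let u , F⊆u       = ultrafilter-extension F-filter ⊥∉F
        a , a∈u , −a∈F = refuted u
    in consistent u a∈u (F⊆u −a∈F)

  -- The Stone space

  -- `φ a` lifted to the universe of `Subset`.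
  ⟪_⟫ : Carrier → Subset
  ⟪ a ⟫ u = Lift (suc (c ⊔ ℓ)) (a ∈ set u)

  ⟪⟫-open : ∀ a → τₛ ⟪ a ⟫
  ⟪⟫-open a (lift a∈u) = a , a∈u , lift

  ⟪⟫-closed : ∀ a → Closed ⟪ a ⟫
  ⟪⟫-closed a {u} a∉u =
    − a , complete u (a∉u ∘ lift) , λ {v} −a∈v (lift a∈v) → consistent v a∈v −a∈v

  ⟪⟫-clopen : ∀ a → Clopen ⟪ a ⟫
  ⟪⟫-clopen a = (λ {u} → ⟪⟫-open a {u}) , (λ {u} → ⟪⟫-closed a {u})

  closedSet : ∀ U → Clopen U → ClosedSet
  closedSet U (_ , U-closed) = U , λ {u} → U-closed {u}

  isTopology : IsTopology
  isTopology = record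
    { respects-≈ = λ U-open (u⊆v , _) u∈U → let a , a∈u , φa⊆U = U-open u∈U in φa⊆U (u⊆v a∈u)
    ; respects-≐ = λ (U⊆V , V⊆U) U-open u∈V →
        let a , a∈u , φa⊆U = U-open (V⊆U u∈V) in a , a∈u , λ p → U⊆V (φa⊆U p)
    ; empty      = λ U-empty u∈U → ⊥-elim (U-empty _ u∈U)
    ; whole      = λ U-whole {u} _ → ⊤ , Ultrafilter.isFilter u .⊤-mem , λ {v} _ → U-whole v
    ; meet       = λ U-open V-open {u} (u∈U , u∈V) →
        let a , a∈u , φa⊆U = U-open u∈U
            b , b∈u , φb⊆V = V-open u∈V
        in a ∧ b , Ultrafilter.isFilter u .∧-closed a∈u b∈u ,
           λ {v} a∧b∈v → φa⊆U (∈-up v (x∧y≤x a b) a∧b∈v) , φb⊆V (∈-up v (x∧y≤y a b) a∧b∈v)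
    ; union      = λ U U-open (i , u∈Uᵢ) →
        let a , a∈u , φa⊆Uᵢ = U-open i u∈Uᵢ in a , a∈u , λ p → i , φa⊆Uᵢ p
    }

  -- The `b` for which finitely many `U i` cover the complement of `φ b` form a filter. Each point
  -- has a basic neighbourhood `φ a` inside some `U i`, which puts `− a` in it; so it contains `⊥`,
  -- and the complement of `φ ⊥` is the whole space.
  compact : Compact
  compact U U-open covers =
    let is , cover = small⁻ CoFinitelyCovered (refuted⇒improper filter refuted)
    in is , λ v → cover v (Ultrafilter.proper v)
    where
    CoFinitelyCovered : Pred Carrier _
    CoFinitelyCovered b = ∃[ is ] (∀ v → b ∉ set v → Any (λ i → v ∈ U i) is)

    filter : IsFilter (small CoFinitelyCovered)
    filter = small-isFilter CoFinitelyCovered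
      ([] , λ v ⊤∉v → ⊥-elim (⊤∉v (Ultrafilter.isFilter v .⊤-mem)))
      (λ a≤b (is , cover) → is , λ v b∉v → cover v (b∉v ∘ ∈-up v a≤b))
      (λ (is , p) (js , q) → is ++ js , λ v a∧b∉v → case-∧ v a∧b∉v is js (p v) (q v))
      where
      case-∧ : ∀ {a b} v → (a ∧ b) ∉ set v → ∀ is js →
               (a ∉ set v → Any (λ i → v ∈ U i) is) → (b ∉ set v → Any (λ i → v ∈ U i) js) →
               Any (λ i → v ∈ U i) (is ++ js)
      case-∧ {a} v a∧b∉v is js p q with em {P = a ∈ set v}
      ... | no a∉v  = ++⁺ˡ (p a∉v)
      ... | yes a∈v = ++⁺ʳ is (q (a∧b∉v ∘ Ultrafilter.isFilter v .∧-closed a∈v))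

    refuted : ∀ u → ∃[ a ] a ∈ set u × (− a) ∈ small CoFinitelyCovered
    refuted u with covers u
    ... | i , u∈Uᵢ with U-open i u∈Uᵢ
    ...   | a , a∈u , φa⊆Uᵢ =
      a , a∈u , small⁺ CoFinitelyCovered (i ∷ [] , λ v −a∉v → here (φa⊆Uᵢ (∉−⇒∈ v −a∉v)))

  hausdorff : Hausdorff
  hausdorff u v u≉v with em {P = ∃[ a ] a ∈ set u × a ∉ set v}
  ... | yes (a , a∈u , a∉v) =
    ⟪ a ⟫ , ⟪ − a ⟫ , (λ {w} → ⟪⟫-open a {w}) , (λ {w} → ⟪⟫-open (− a) {w}) ,
    lift a∈u , lift (complete v a∉v) , λ w (lift a∈w , lift −a∈w) → consistent w a∈w −a∈w
  -- Without a separating element `u` is included in `v`, and maximality of `u` makes them equal.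
  ... | no none = ⊥-elim (u≉v (u⊆v , maximal u (set v) (isFilter v) (proper v) u⊆v))
    where
    open Ultrafilter using (isFilter; proper; maximal)
    u⊆v : set u ⊆ set v
    u⊆v a∈u = decidable-stable em λ a∉v → none (_ , a∈u , a∉v)

  zeroDimensional : ZeroDimensional
  zeroDimensional U-open u∈U with U-open u∈U
  ... | a , a∈u , φa⊆U = ⟪ a ⟫ , ⟪⟫-clopen a , lift a∈u , φa⊆U ∘ lower

  isBooleanSpace : IsBooleanSpace
  isBooleanSpace = record
    { isTopology      = isTopology
    ; compact         = compact
    ; hausdorff       = hausdorff
    ; zeroDimensional = zeroDimensional
    }

  -- The filter F_Y.
  ⋀ : Subset → Pred Carrier (c ⊔ ℓ)
  ⋀ Y = small (λ a → Y ⊆ φ a)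

  ⋀-isFilter : ∀ Y → IsFilter (⋀ Y)
  ⋀-isFilter Y = small-isFilter (λ a → Y ⊆ φ a)
    (λ {u} _ → Ultrafilter.isFilter u .⊤-mem)
    (λ a≤b Y⊆φa {u} u∈Y → ∈-up u a≤b (Y⊆φa u∈Y))
    (λ Y⊆φa Y⊆φb {u} u∈Y → Ultrafilter.isFilter u .∧-closed (Y⊆φa u∈Y) (Y⊆φb u∈Y))

  -- A point outside `Y` has a neighbourhood `φ a` missing `Y`; then `− a` is in `⋀ Y` but not in
  -- the point.
  closed⇒φF : ∀ {Y} → Closed Y → Y ≐ φF (⋀ Y)
  closed⇒φF {Y} Y-closed =
      (λ u∈Y a∈⋀Y → small⁻ (λ a → Y ⊆ φ a) a∈⋀Y u∈Y)
    , (λ {u} ⋀Y⊆u → decidable-stable em λ u∉Y →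
        let a , a∈u , φa⊆∁Y = Y-closed u∉Y
        in consistent u a∈u (⋀Y⊆u (small⁺ (λ a → Y ⊆ φ a)
             (λ {v} v∈Y → complete v (λ a∈v → φa⊆∁Y a∈v v∈Y)))))

  -- `Reaches` is generated by `F` and the complement of `U`. No ultrafilter is compatible with
  -- both, so it reaches `⊥`: for some `a` in `F`, nothing of `φ a` lies outside `U`.
  φF⊆open⇒φ⊆open : ∀ {F U} → IsFilter F → τₛ U → φF F ⊆ U → ∃[ a ] a ∈ F × φ a ⊆ U
  φF⊆open⇒φ⊆open {F} {U} F-filter U-open φF⊆U =
    let a , a∈F , p = small⁻ Reaches (refuted⇒improper filter refuted)
    in a , a∈F , λ {v} a∈v → decidable-stable em λ v∉U → Ultrafilter.proper v (p v a∈v v∉U)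
    where
    Reaches : Pred Carrier _
    Reaches b = ∃[ a ] a ∈ F × (∀ v → a ∈ set v → v ∉ U → b ∈ set v)

    filter : IsFilter (small Reaches)
    filter = small-isFilter Reaches
      (⊤ , F-filter .⊤-mem , λ v ⊤∈v _ → ⊤∈v)
      (λ b≤b′ (a , a∈F , p) → a , a∈F , λ v a∈v v∉U → ∈-up v b≤b′ (p v a∈v v∉U))
      (λ (a , a∈F , p) (a′ , a′∈F , q) → a ∧ a′ , F-filter .∧-closed a∈F a′∈F ,
        λ v a∧a′∈v v∉U → Ultrafilter.isFilter v .∧-closed
          (p v (∈-up v (x∧y≤x a a′) a∧a′∈v) v∉U) (q v (∈-up v (x∧y≤y a a′) a∧a′∈v) v∉U))

    refuted : ∀ u → ∃[ a ] a ∈ set u × (− a) ∈ small Reaches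
    refuted u with em {P = u ∈ U}
    ... | yes u∈U with U-open u∈U
    ...   | a , a∈u , φa⊆U =
      a , a∈u , small⁺ Reaches (⊤ , F-filter .⊤-mem , λ v _ v∉U → complete v (v∉U ∘ φa⊆U))
    refuted u | no u∉U with em {P = ∃[ a ] a ∈ F × a ∉ set u}
    -- Here `− a` is in `u`, while its complement lies above `a` in `F`.
    ... | yes (a , a∈F , a∉u) = − a , complete u a∉u ,
      small⁺ Reaches (a , a∈F , λ v a∈v _ → ∈-up v ≤−− a∈v)
    ... | no F⊆u = ⊥-elim (u∉U (φF⊆U λ a∈F → decidable-stable em λ a∉u → F⊆u (_ , a∈F , a∉u)))

  -- Closedness makes `U` equal to `φF (⋀ U)`; openness then lets one member of `⋀ U` suffice.
  clopen⇒φ : ∀ {U} → Clopen U → ∃[ a ] U ≐ φ a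
  clopen⇒φ {U} (U-open , U-closed) =
    let a , a∈⋀U , φa⊆U =
          φF⊆open⇒φ⊆open (⋀-isFilter U) U-open (proj₂ (closed⇒φF U-closed))
    in a , small⁻ (λ a → U ⊆ φ a) a∈⋀U , φa⊆U

  -- The ternary relation

  -- With `T⇐`, this removes the existential filter from `Tᴬ`: by `φF⊆φ⇒∈`, any witness contains
  -- every `a` with `Y` inside `φ a`.
  T⇒ : ∀ u v (Y : ClosedSet) → v ∈ Tᴬ u Y →
       ∀ {a b} → proj₁ Y ⊆ φ a → (a ⇒ b) ∈ set u → b ∈ set v
  T⇒ u v Y (F , F-filter , (_ , φF⊆Y) , D⊆v) {a} Y⊆φa a⇒b∈u =
    D⊆v (a , φF⊆φ⇒∈ F-filter (λ {w} F⊆w → Y⊆φa (φF⊆Y {w} F⊆w)) , a⇒b∈u)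

  T⇐ : ∀ u v (Y : ClosedSet) →
       (∀ {a b} → proj₁ Y ⊆ φ a → (a ⇒ b) ∈ set u → b ∈ set v) → v ∈ Tᴬ u Y
  T⇐ u v (Y , Y-closed) h = ⋀ Y , ⋀-isFilter Y , closed⇒φF Y-closed ,
    λ (a , a∈⋀Y , a⇒b∈u) → h (small⁻ (λ a → Y ⊆ φ a) a∈⋀Y) a⇒b∈u

  T-resp : ∀ {u u′ v v′} {Y Y′ : ClosedSet} → set u ≐ set u′ → proj₁ Y ≐ proj₁ Y′ →
           set v ≐ set v′ → v ∈ Tᴬ u Y → v′ ∈ Tᴬ u′ Y′
  T-resp {u} {u′} {v} {v′} {Y} {Y′} (_ , u′⊆u) (Y⊆Y′ , _) (v⊆v′ , _) T =
    T⇐ u′ v′ Y′ λ Y′⊆φa a⇒b∈u′ →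
      v⊆v′ (T⇒ u v Y T (λ w∈Y → Y′⊆φa (Y⊆Y′ w∈Y)) (u′⊆u a⇒b∈u′))

  -- Failure at `v` comes from a single consequent `b` outside `v`, and `φ (− b)` is a neighbourhood
  -- of `v` on which it persists.
  T1 : ∀ u (Y : ClosedSet) → Closed (Tᴬ u Y)
  T1 u Y {v} ¬T with em {P = ∃[ a ] ∃[ b ] proj₁ Y ⊆ φ a × (a ⇒ b) ∈ set u × b ∉ set v}
  ... | yes (a , b , Y⊆φa , a⇒b∈u , b∉v) =
    − b , complete v b∉v , λ {w} −b∈w T → consistent w (T⇒ u w Y T Y⊆φa a⇒b∈u) −b∈w
  ... | no none = ⊥-elim (¬T (T⇐ u v Y λ {a} {b} Y⊆φa a⇒b∈u →
    decidable-stable em λ b∉v → none (a , b , Y⊆φa , a⇒b∈u , b∉v)))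

  -- The filter conditions are `⇒-⊤`, monotonicity in the consequent and `⇒-∧`.
  consequents-isFilter : ∀ a u → IsFilter (λ b → (a ⇒ b) ∈ set u)
  consequents-isFilter a u = record
    { ⊤-mem    = ∈-up u ⊤≤⇒⊤ (Ultrafilter.isFilter u .⊤-mem)
    ; upward   = λ b≤b′ → ∈-up u (⇒-monoʳ-≤ b≤b′)
    ; ∧-closed = λ p q → ∈-up u (≤-reflexive (⇒-∧ a _ _)) (Ultrafilter.isFilter u .∧-closed p q)
    }

  φ⊆φ⇒≤ : ∀ {a b} → φ a ⊆ φ b → a ≤ b
  φ⊆φ⇒≤ {a} φa⊆φb = lower (φF⊆φ⇒∈ (↑-isFilter a) λ {u} ↑a⊆u → φa⊆φb {u} (↑a⊆u (lift ≤-refl)))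

  φ-⇒ : ∀ {U V a b} → Clopen U → U ≐ φ a → V ≐ φ b → ⟪ a ⇒ b ⟫ ≐ Conditional Tᴬ U V
  φ-⇒ {U} {V} {a} {b} U-clopen (U⊆φa , φa⊆U) (V⊆φb , φb⊆V) =
    (λ {u} → ⊆-Conditional {u}) , (λ {u} → Conditional-⊆ {u})
    where
    ⊆-Conditional : ⟪ a ⇒ b ⟫ ⊆ Conditional Tᴬ U V
    ⊆-Conditional {u} (lift a⇒b∈u) Z Z⊆U {v} T =
      φb⊆V {v} (T⇒ u v Z T (λ w∈Z → U⊆φa (Z⊆U w∈Z)) a⇒b∈u)

    Y : ClosedSet
    Y = closedSet U U-clopen

    Conditional-⊆ : Conditional Tᴬ U V ⊆ ⟪ a ⇒ b ⟫
    Conditional-⊆ {u} u∈U→V = lift (decidable-stable em λ a⇒b∉u →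
      let v , consequents⊆v , b∉v = separation (consequents-isFilter a u) a⇒b∉u
      -- The test set is `U` itself. Any `a′` with `U` inside `φ a′` is above `a`, so antitonicity
      -- turns `a′ ⇒ d` in `u` into `a ⇒ d` in `u`.
      in b∉v (V⊆φb (u∈U→V Y id {v} (T⇐ u v Y λ U⊆φa′ a′⇒d∈u →
           consequents⊆v (∈-up u (⇒-antiˡ-≤ (φ⊆φ⇒≤ λ {w} a∈w → U⊆φa′ (φa⊆U {w} a∈w))) a′⇒d∈u)))))

  T2 : ∀ {U V} → Clopen U → Clopen V → Σ[ W ∈ Subset ] Clopen W × W ≐ Conditional Tᴬ U V
  T2 U-clopen V-clopen =
    let a , U≐φa = clopen⇒φ U-clopen
        b , V≐φb = clopen⇒φ V-clopen
    in ⟪ a ⇒ b ⟫ , ⟪⟫-clopen (a ⇒ b) , φ-⇒ U-clopen U≐φa V≐φb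

  T3 : ∀ u (Y : ClosedSet) v →
       v ∈ Tᴬ u Y ⇔
       (∀ U (clopen : Clopen U) → proj₁ Y ⊆ U → v ∈ Tᴬ u (closedSet U clopen))
  T3 u Y v = mk⇔
    (λ T U U-clopen Y⊆U →
      T⇐ u v (closedSet U U-clopen) λ U⊆φa → T⇒ u v Y T (λ w∈Y → U⊆φa (Y⊆U w∈Y)))
    -- Each antecedent `a` with `Y` inside `φ a` is handled by the clopen set `⟪ a ⟫`.
    (λ h → T⇐ u v Y λ {a} Y⊆φa → T⇒ u v (closedSet ⟪ a ⟫ (⟪⟫-clopen a))
      (h ⟪ a ⟫ (⟪⟫-clopen a) (λ {w} w∈Y → lift (Y⊆φa {w} w∈Y))) {a} lower)

theorem5p4 : (∀ {p} → ExcludedMiddle p) → (∀ {a b} → Extensionality a b) →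
    ∀ {c ℓ} (𝔸 : ConditionalAlgebra c ℓ) →
    let open StoneSpace 𝔸 in
    Topology.IsConditionalSpace Ul τₛ Tᴬ
theorem5p4 em ext 𝔸 = record
  { isBooleanSpace = isBooleanSpace
  ; T-resp         = λ {u} {u′} {v} {v′} {Y} {Y′} → T-resp {u} {u′} {v} {v′} {Y} {Y′}
  ; T1             = T1
  ; T2             = T2
  ; T3             = T3
  }
  where open StoneDuality em ext 𝔸
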